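{- Let $N \in \mathbb{N}$, $k \ge 1$, $R \in \mathbb{Z}/N\mathbb{Z}$, and $Q = \pi'_N(k)$. Then $f_{k,R}$ is quasipolynomial with quasi-period $Q$; moreover, for each $i \in \{0, 1, \ldots, Q-1\}$ the function $\mathcal{L}^{(i)}_{k,R}$ defined by $f_{k,R}(n) = \mathcal{L}^{(i)}_{k,R}\!\left(\frac{n-i}{Q}\right)$ for $n \equiv i \pmod Q$ is linear, i.e. there are constants $a_i, b_i$ with $f_{k,R}(n) = a_i\frac{n-i}{Q} + b_i$ for all $n \ge k$ with $n \equiv i \pmod{Q}$.
   Context: The Gaussian polynomial is $\begin{bmatrix} n \\ k \end{bmatrix}_q = \frac{[n]!}{[n-k]!\,[k]!}$ with $[m]! = \prod_{i=1}^{m} \frac{1-q^i}{1-q}$, a polynomial of degree $k(n-k)$. For $n \ge k$, $f_{k,R}(n) = \#\{\alpha \in \{0,\ldots,k(n-k)\} : [q^\alpha]\begin{bmatrix} n \\ k \end{bmatrix}_q \equiv R \pmod N\}$. A function $f$ is quasipolynomial with quasi-period $Q$ if there are polynomials $P_0,\ldots,P_{Q-1}$ with $f(n) = P_i(n)$ whenever $n \equiv i \pmod Q$. $p_{\le k}(n)$ is the number of partitions of $n$ with at most $k$ parts; $\pi_N(k)$ is the minimal period of the purely periodic sequence $(p_{\le k}(n) \bmod N)_{n \ge 0}$ (so $\pi_N(1)=1$). Define $\pi'_N(1) = \pi_N(1) = 1$ and for $k \ge 2$: $\pi'_N(k) = \frac{\pi_N(k)}{\pi_N(k-1)}\pi'_N(k-1)$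 if $N$ divides $\frac{\pi_N(k)}{\pi_N(k-1)}$, and $\pi'_N(k) = N\frac{\pi_N(k)}{\pi_N(k-1)}\pi'_N(k-1)$ otherwise. -}

module Defs where

open import Data.Nat as ℕ using (ℕ; zero; suc; _∸_; _≤_; NonZero)
open import Data.Nat.Divisibility using (_∣?_)
open import Data.Nat.DivMod using (_/_; _%_)
open import Data.Integer as ℤ using (ℤ; +_)
open import Data.Integer.DivMod using (_%ℕ_)
open import Data.Fin using (Fin; toℕ)
open import Data.List using (List; []; _∷_; length; filter; upTo)
open import Data.Bool using (if_then_else_)
open import Data.Product using (_×_)
open import Relation.Nullary using (does)
open import Relation.Binary.PropositionalEquality using (_≡_)

Series : Set
Series = ℕ → ℤ

sumTo : ℕ → (ℕ → ℤ) → ℤ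
sumTo zero    f = f 0
sumTo (suc n) f = sumTo n f ℤ.+ f (suc n)

_⊛_ : Series → Series → Series
(f ⊛ g) n = sumTo n (λ i → f i ℤ.* g (n ∸ i))

one : Series
one zero    = + 1
one (suc _) = + 0

qpow : ℕ → Series
qpow i j = if does (i ℕ.≟ j) then + 1 else + 0

_⊖ₛ_ : Series → Series → Series
(f ⊖ₛ g) n = f n ℤ.- g n

-- Inverse of a series g with constant term 1:
-- c₀ = 1,  c_j = - Σ_{i=1}^{j} g_i c_{j-i}.
-- invRev g j is the list [c_j, c_{j-1}, …, c_0].
private
  dot : Series → ℕ → List ℤ → ℤ
  dot g i []       = + 0
  dot g i (c ∷ cs) = g i ℤ.* c ℤ.+ dot g (suc i) cs

invRev : Series → ℕ → List ℤ
invRev g zero    = + 1 ∷ []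
invRev g (suc j) = let cs = invRev g j in ℤ.- dot g 1 cs ∷ cs

headℤ : List ℤ → ℤ
headℤ []      = + 0
headℤ (c ∷ _) = c

-- g⁻¹ as a power series (meaningful when g 0 = 1)
inv : Series → Series
inv g j = headℤ (invRev g j)

qint : ℕ → Series
qint i = (one ⊖ₛ qpow i) ⊛ inv (one ⊖ₛ qpow 1)

qfact : ℕ → Series
qfact zero    = one
qfact (suc m) = qfact m ⊛ qint (suc m)

gauss : ℕ → ℕ → Series
gauss n k = qfact n ⊛ inv (qfact (n ∸ k) ⊛ qfact k)

fkR : (N : ℕ) .{{_ : NonZero N}} → (k : ℕ) → Fin N → ℕ → ℕ
fkR N k R n =
  length (filter (λ α → (gauss n k α %ℕ N) ℕ.≟ toℕ R)
                 (upTo (suc (k ℕ.* (n ∸ k)))))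

-- Partitions with at most k parts.
-- decSeqs k b n = number of weakly decreasing sequences
--   b ≥ x₁ ≥ x₂ ≥ … ≥ x_k ≥ 0 of naturals with x₁ + … + x_k = n.

sumℕ : ℕ → (ℕ → ℕ) → ℕ
sumℕ zero    f = f 0
sumℕ (suc n) f = sumℕ n f ℕ.+ f (suc n)

decSeqs : ℕ → ℕ → ℕ → ℕ
decSeqs zero    b zero    = 1
decSeqs zero    b (suc n) = 0
decSeqs (suc k) b n       = sumℕ (ℕ._⊓_ b n) (λ x → decSeqs k x (n ∸ x))

-- p_{≤k}(n): partitions of n with at most k parts (parts padded by zeros)
pLe : ℕ → ℕ → ℕ
pLe k n = decSeqs k n n

IsPeriod : (N : ℕ) .{{_ : NonZero N}} → ℕ → ℕ → Set
IsPeriod N k p = 1 ≤ p × (∀ n → pLe k (n ℕ.+ p) % N ≡ pLe k n % N)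

IsMinimalPeriod : (N : ℕ) .{{_ : NonZero N}} → ℕ → ℕ → Set
IsMinimalPeriod N k p = IsPeriod N k p × (∀ q → IsPeriod N k q → p ≤ q)

divℕ : ℕ → ℕ → ℕ
divℕ a zero    = 0
divℕ a (suc b) = a / suc b

pi' : (N : ℕ) → (ℕ → ℕ) → ℕ → ℕ
pi' N π zero          = 1
pi' N π (suc zero)    = π 1
pi' N π (suc (suc j)) =
  let r = divℕ (π (suc (suc j))) (π (suc j)) in
  if does (N ∣? r) then r ℕ.* pi' N π (suc j)
                   else N ℕ.* r ℕ.* pi' N π (suc j)

{-# OPTIONS --safe #-}

-- Put M = n - k. The Gaussian polynomial is ∏_{j=1}^{k} (1 - q^{M+j}) times P_k = Σ p_{≤k}(m) q^m,
-- so expanding the product in powers of z = q^M gives Σ_{s≤k} q^{sM} F_s, with series F_s that do not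
-- depend on M. Let T be a period of p_{≤k} mod N. Then (1 - q^T) P_k is mod N a polynomial of degree
-- at most T - k(k+1)/2; for s < k the polynomial F_s / P_k has degree below k(k+1)/2, so
-- (1 - q^T) F_s has degree below T and F_s is purely T-periodic mod N. Cut the exponents into blocks
-- r M + β with r < k, β < M, and the top exponent k M. Replacing M by T + M, each block keeps its
-- residues both when aligned on the left and when aligned on the right. Hence it gains T residues
-- which are unchanged when M is increased by T once more, so the count grows linearly along
-- M + T ℕ. Finally π(k-1) divides π(k), because p_{≤k-1} inherits the period of p_{≤k}, and so
-- T = π'(k) is a multiple of π(k).
module Submission where

open import Defs
open import Data.Nat using (ℕ; _+_; _*_; _≤_; _<_; NonZero)
open import Data.Integer using (ℤ; +_) renaming (_+_ to _+ℤ_; _*_ to _*ℤ_)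
open import Data.Fin using (Fin)
open import Data.Product using (∃₂)
open import Relation.Binary.PropositionalEquality using (_≡_)
open import Data.Nat as ℕ using (zero; suc; z≤n; s≤s; _∸_; _⊓_; _≤?_; _≟_)
open import Data.Nat.Divisibility using (_∣_; divides; _∣?_; ∣-refl; ∣n⇒∣m*n; *-monoʳ-∣; m%n≡0⇒n∣m; >⇒∤)
open import Data.Nat.DivMod using (_/_; _%_; m%n<n; m≡m%n+[m/n]*n; m/n*n≡m)
import Data.Nat.Properties as ℕₚ
open import Data.Nat.Tactic.RingSolver using () renaming (solve-∀ to ℕ-solve-∀)
open import Data.Integer as ℤ using (-_; _-_)
open import Data.Integer.DivMod using (_%ℕ_; _/ℕ_; n%ℕd<d; a≡a%ℕn+[a/ℕn]*n)
open import Data.Integer.Divisibility.Signed as Signed using () renaming (_∣_ to _∣ℤ_)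
import Data.Integer.Properties as ℤₚ
open import Data.Integer.Tactic.RingSolver using (solve-∀)
open import Data.Bool using (true; false; if_then_else_)
open import Data.Empty using (⊥-elim)
open import Data.Fin using (toℕ)
open import Data.List using (List; []; _∷_; _++_; length; filter; upTo)
open import Data.List.Properties using (upTo-∷ʳ; filter-++; length-++)
open import Data.Product using (Σ; _×_; _,_; proj₁)
open import Data.Sum using (inj₁; inj₂)
open import Level using (0ℓ)
open import Algebra.Bundles using (CommutativeMonoid)
import Algebra.Solver.CommutativeMonoid as CMSolver
open import Relation.Nullary using (Dec; yes; no; does)
open import Relation.Binary.PropositionalEquality using (refl; sym; trans; cong; cong₂; subst; module ≡-Reasoning)

open ≡-Reasoning

-- Power series

infix 4 _≈_
_≈_ : Series → Series → Set
f ≈ g = ∀ n → f n ≡ g n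

tail : Series → Series
tail f n = f (suc n)

sumTo-cong : ∀ n {f g : Series} → (∀ i → i ≤ n → f i ≡ g i) → sumTo n f ≡ sumTo n g
sumTo-cong zero    eq = eq 0 z≤n
sumTo-cong (suc n) eq =
  cong₂ _+ℤ_ (sumTo-cong n λ i i≤n → eq i (ℕₚ.m≤n⇒m≤1+n i≤n)) (eq (suc n) ℕₚ.≤-refl)

sumTo-head : ∀ n (f : Series) → sumTo (suc n) f ≡ f 0 +ℤ sumTo n (tail f)
sumTo-head zero    f = refl
sumTo-head (suc n) f =
  trans (cong (_+ℤ f (suc (suc n))) (sumTo-head n f)) (ℤₚ.+-assoc (f 0) _ _)

sumTo-linear : ∀ n a (f g : Series) →
  sumTo n (λ i → a *ℤ f i +ℤ g i) ≡ a *ℤ sumTo n f +ℤ sumTo n g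
sumTo-linear zero    a f g = refl
sumTo-linear (suc n) a f g = trans
  (cong (_+ℤ (a *ℤ f (suc n) +ℤ g (suc n))) (sumTo-linear n a f g))
  (regroup a (sumTo n f) (sumTo n g) (f (suc n)) (g (suc n)))
  where
  regroup : ∀ a x y u v → (a *ℤ x +ℤ y) +ℤ (a *ℤ u +ℤ v) ≡ a *ℤ (x +ℤ u) +ℤ (y +ℤ v)
  regroup = solve-∀

⊛-cong : ∀ {f f′ g g′} → f ≈ f′ → g ≈ g′ → (f ⊛ g) ≈ (f′ ⊛ g′)
⊛-cong p q n = sumTo-cong n λ i _ → cong₂ _*ℤ_ (p i) (q (n ∸ i))

-- Scaling and addition are treated together because `⊛-head` gives `tail (f ⊛ g)` as `f 0` times
-- `tail g` plus `tail f ⊛ g`, and `⊛-assoc` has to multiply that by `h`.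
⊛-linearˡ : ∀ a f g h → ((λ i → a *ℤ f i +ℤ g i) ⊛ h) ≈ (λ n → a *ℤ (f ⊛ h) n +ℤ (g ⊛ h) n)
⊛-linearˡ a f g h n = trans
  (sumTo-cong n λ i _ → expand a (f i) (g i) (h (n ∸ i)))
  (sumTo-linear n a (λ i → f i *ℤ h (n ∸ i)) (λ i → g i *ℤ h (n ∸ i)))
  where
  expand : ∀ a x y z → (a *ℤ x +ℤ y) *ℤ z ≡ a *ℤ (x *ℤ z) +ℤ y *ℤ z
  expand = solve-∀

⊛-head : ∀ f g n → (f ⊛ g) (suc n) ≡ f 0 *ℤ g (suc n) +ℤ (tail f ⊛ g) n
⊛-head f g n = sumTo-head n (λ i → f i *ℤ g (suc n ∸ i))

-- Mirror image of `⊛-head`: one recursion for `f ⊛ g` and the other for `g ⊛ f` give commutativity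
-- by induction, without reversing a sum.
⊛-last : ∀ f g n → (f ⊛ g) (suc n) ≡ (f ⊛ tail g) n +ℤ f (suc n) *ℤ g 0
⊛-last f g n = cong₂ _+ℤ_
  (sumTo-cong n λ i i≤n → cong (λ m → f i *ℤ g m) (ℕₚ.+-∸-assoc 1 i≤n))
  (cong (λ m → f (suc n) *ℤ g m) (ℕₚ.n∸n≡0 n))

⊛-comm : ∀ f g → (f ⊛ g) ≈ (g ⊛ f)
⊛-comm f g zero    = ℤₚ.*-comm (f 0) (g 0)
⊛-comm f g (suc n) = begin
  (f ⊛ g) (suc n)                        ≡⟨ ⊛-head f g n ⟩
  f 0 *ℤ g (suc n) +ℤ (tail f ⊛ g) n     ≡⟨ cong₂ _+ℤ_ (ℤₚ.*-comm (f 0) _) (⊛-comm (tail f) g n) ⟩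
  g (suc n) *ℤ f 0 +ℤ (g ⊛ tail f) n     ≡⟨ ℤₚ.+-comm (g (suc n) *ℤ f 0) _ ⟩
  (g ⊛ tail f) n +ℤ g (suc n) *ℤ f 0     ≡⟨ ⊛-last g f n ⟨
  (g ⊛ f) (suc n)                        ∎

⊛-assoc : ∀ f g h → ((f ⊛ g) ⊛ h) ≈ (f ⊛ (g ⊛ h))
⊛-assoc f g h zero    = ℤₚ.*-assoc (f 0) (g 0) (h 0)
⊛-assoc f g h (suc n) = begin
  ((f ⊛ g) ⊛ h) (suc n)
    ≡⟨ ⊛-head (f ⊛ g) h n ⟩
  (f 0 *ℤ g 0) *ℤ h (suc n) +ℤ (tail (f ⊛ g) ⊛ h) n
    ≡⟨ cong ((f 0 *ℤ g 0) *ℤ h (suc n) +ℤ_) (⊛-cong {g = h} (⊛-head f g) (λ _ → refl) n) ⟩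
  (f 0 *ℤ g 0) *ℤ h (suc n) +ℤ ((λ i → f 0 *ℤ tail g i +ℤ (tail f ⊛ g) i) ⊛ h) n
    ≡⟨ cong ((f 0 *ℤ g 0) *ℤ h (suc n) +ℤ_) (⊛-linearˡ (f 0) (tail g) (tail f ⊛ g) h n) ⟩
  (f 0 *ℤ g 0) *ℤ h (suc n) +ℤ (f 0 *ℤ (tail g ⊛ h) n +ℤ ((tail f ⊛ g) ⊛ h) n)
    ≡⟨ regroup (f 0) (g 0) (h (suc n)) ((tail g ⊛ h) n) (((tail f ⊛ g) ⊛ h) n) ⟩
  f 0 *ℤ (g 0 *ℤ h (suc n) +ℤ (tail g ⊛ h) n) +ℤ ((tail f ⊛ g) ⊛ h) n
    ≡⟨ cong₂ (λ x y → f 0 *ℤ x +ℤ y) (sym (⊛-head g h n)) (⊛-assoc (tail f) g h n) ⟩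
  f 0 *ℤ (g ⊛ h) (suc n) +ℤ (tail f ⊛ (g ⊛ h)) n
    ≡⟨ ⊛-head f (g ⊛ h) n ⟨
  (f ⊛ (g ⊛ h)) (suc n) ∎
  where
  regroup : ∀ a b c x y → (a *ℤ b) *ℤ c +ℤ (a *ℤ x +ℤ y) ≡ a *ℤ (b *ℤ c +ℤ x) +ℤ y
  regroup = solve-∀

⊛-zeroˡ : ∀ f → ((λ _ → + 0) ⊛ f) ≈ (λ _ → + 0)
⊛-zeroˡ f zero    = refl
⊛-zeroˡ f (suc n) = trans (⊛-head (λ _ → + 0) f n) (cong (+ 0 +ℤ_) (⊛-zeroˡ f n))

⊛-identityˡ : ∀ f → (one ⊛ f) ≈ f
⊛-identityˡ f zero    = ℤₚ.*-identityˡ (f 0)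
⊛-identityˡ f (suc n) = begin
  (one ⊛ f) (suc n)                               ≡⟨ ⊛-head one f n ⟩
  + 1 *ℤ f (suc n) +ℤ ((λ _ → + 0) ⊛ f) n         ≡⟨ cong₂ _+ℤ_ (ℤₚ.*-identityˡ (f (suc n))) (⊛-zeroˡ f n) ⟩
  f (suc n) +ℤ + 0                                ≡⟨ ℤₚ.+-identityʳ (f (suc n)) ⟩
  f (suc n)                                       ∎

⊛-commutativeMonoid : CommutativeMonoid 0ℓ 0ℓ
⊛-commutativeMonoid = record
  { Carrier = Series ; _≈_ = _≈_ ; _∙_ = _⊛_ ; ε = one
  ; isCommutativeMonoid = record
    { isMonoid = record
      { isSemigroup = record
        { isMagma = record
          { isEquivalence = record
            { refl  = λ _ → refl
            ; sym   = λ p n → sym (p n)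
            ; trans = λ p q n → trans (p n) (q n) }
          ; ∙-cong = ⊛-cong }
        ; assoc = ⊛-assoc }
      ; identity = ⊛-identityˡ , λ f n → trans (⊛-comm f one n) (⊛-identityˡ f n) }
    ; comm = ⊛-comm }
  }

-- The recursion behind `inv` is private in Defs; unification recovers it.
mutual
  revDot : Series → ℕ → List ℤ → ℤ
  revDot = _

  inv-suc-revDot : ∀ g j → inv g (suc j) ≡ - revDot g 1 (invRev g j)
  -- Abstracting the list and the start index leaves `revDot` applied to distinct variables, so
  -- `refl` determines it.
  inv-suc-revDot g j with invRev g j | 1
  ... | cs | i = refl

-- `invRev g j` lists the coefficients of the inverse from index j downwards, so pairing it with
-- ascending indices of `g` is a convolution.
revDot-invRev : ∀ g i j → revDot g i (invRev g j) ≡ ((λ l → g (i + l)) ⊛ inv g) j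
revDot-invRev g i zero    = trans (ℤₚ.+-identityʳ _) (cong (λ m → g m *ℤ + 1) (sym (ℕₚ.+-identityʳ i)))
revDot-invRev g i (suc j) = begin
  g i *ℤ inv g (suc j) +ℤ revDot g (suc i) (invRev g j)
    ≡⟨ cong₂ _+ℤ_ (cong (λ m → g m *ℤ inv g (suc j)) (sym (ℕₚ.+-identityʳ i)))
                  (revDot-invRev g (suc i) j) ⟩
  g (i + 0) *ℤ inv g (suc j) +ℤ ((λ l → g (suc i + l)) ⊛ inv g) j
    ≡⟨ cong (g (i + 0) *ℤ inv g (suc j) +ℤ_)
         (⊛-cong {g = inv g} (λ l → cong g (sym (ℕₚ.+-suc i l))) (λ _ → refl) j) ⟩
  g (i + 0) *ℤ inv g (suc j) +ℤ ((λ l → g (i + suc l)) ⊛ inv g) j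
    ≡⟨ ⊛-head (λ l → g (i + l)) (inv g) j ⟨
  ((λ l → g (i + l)) ⊛ inv g) (suc j) ∎

⊛-inverseʳ : ∀ g → g 0 ≡ + 1 → (g ⊛ inv g) ≈ one
⊛-inverseʳ g g0 zero    = cong (_*ℤ + 1) g0
⊛-inverseʳ g g0 (suc j) = begin
  (g ⊛ inv g) (suc j)
    ≡⟨ ⊛-head g (inv g) j ⟩
  g 0 *ℤ inv g (suc j) +ℤ (tail g ⊛ inv g) j
    ≡⟨ cong₂ (λ x y → x *ℤ y +ℤ (tail g ⊛ inv g) j) g0
         (trans (inv-suc-revDot g j) (cong -_ (revDot-invRev g 1 j))) ⟩
  + 1 *ℤ - (tail g ⊛ inv g) j +ℤ (tail g ⊛ inv g) j
    ≡⟨ cong (_+ℤ (tail g ⊛ inv g) j) (ℤₚ.*-identityˡ (- (tail g ⊛ inv g) j)) ⟩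
  - (tail g ⊛ inv g) j +ℤ (tail g ⊛ inv g) j
    ≡⟨ ℤₚ.+-inverseˡ ((tail g ⊛ inv g) j) ⟩
  + 0 ∎

-- Multiplication by q^a and by 1 - q^a

shift : ℕ → Series → Series
shift zero    f n       = f n
shift (suc a) f zero    = + 0
shift (suc a) f (suc n) = shift a f n

-- Multiplication by 1 - q^a in difference form: it ties degree bounds to periodicity, since `Δ T f`
-- at `T + n` is `f (T + n) - f n`.
Δ : ℕ → Series → Series
Δ a f = f ⊖ₛ shift a f

shift-cong : ∀ a {f g} → f ≈ g → shift a f ≈ shift a g
shift-cong zero    p n       = p n
shift-cong (suc a) p zero    = refl
shift-cong (suc a) p (suc n) = shift-cong a p n

shift-⊖ : ∀ a f g → shift a (f ⊖ₛ g) ≈ (shift a f ⊖ₛ shift a g)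
shift-⊖ zero    f g n       = refl
shift-⊖ (suc a) f g zero    = refl
shift-⊖ (suc a) f g (suc n) = shift-⊖ a f g n

shift-zero : ∀ a → shift a (λ _ → + 0) ≈ (λ _ → + 0)
shift-zero zero    n       = refl
shift-zero (suc a) zero    = refl
shift-zero (suc a) (suc n) = shift-zero a n

shift-shift : ∀ a b f → shift a (shift b f) ≈ shift (a + b) f
shift-shift zero    b f n       = refl
shift-shift (suc a) b f zero    = refl
shift-shift (suc a) b f (suc n) = shift-shift a b f n

shift-comm : ∀ a b f → shift a (shift b f) ≈ shift b (shift a f)
shift-comm a b f n = begin
  shift a (shift b f) n  ≡⟨ shift-shift a b f n ⟩
  shift (a + b) f n      ≡⟨ cong (λ c → shift c f n) (ℕₚ.+-comm a b) ⟩
  shift (b + a) f n      ≡⟨ shift-shift b a f n ⟨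
  shift b (shift a f) n  ∎

shift-+ : ∀ a f n → shift a f (a + n) ≡ f n
shift-+ zero    f n = refl
shift-+ (suc a) f n = shift-+ a f n

shift-< : ∀ {a n} f → n < a → shift a f n ≡ + 0
shift-< {suc a} {zero}  f _         = refl
shift-< {suc a} {suc n} f (s≤s n<a) = shift-< f n<a

⊖-cong : ∀ {f f′ g g′} → f ≈ f′ → g ≈ g′ → (f ⊖ₛ g) ≈ (f′ ⊖ₛ g′)
⊖-cong p q n = cong₂ _-_ (p n) (q n)

Δ-cong : ∀ a {f g} → f ≈ g → Δ a f ≈ Δ a g
Δ-cong a {f} {g} p = ⊖-cong {f} {g} p (shift-cong a p)

shift-Δ : ∀ a b f → shift a (Δ b f) ≈ Δ b (shift a f)
shift-Δ a b f n = trans (shift-⊖ a f (shift b f) n) (cong (λ x → shift a f n - x) (shift-comm a b f n))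

Δ-⊖ : ∀ a f g → Δ a (f ⊖ₛ g) ≈ (Δ a f ⊖ₛ Δ a g)
Δ-⊖ a f g n = trans (cong (λ x → (f n - g n) - x) (shift-⊖ a f g n)) (regroup (f n) (g n) _ _)
  where
  regroup : ∀ x y u v → (x - y) - (u - v) ≡ (x - u) - (y - v)
  regroup = solve-∀

Δ-comm : ∀ a b f → Δ a (Δ b f) ≈ Δ b (Δ a f)
Δ-comm a b f n = sym (trans (Δ-⊖ b f (shift a f) n) (cong (λ x → Δ b f n - x) (sym (shift-Δ a b f n))))

oneMinus : ℕ → Series
oneMinus a = one ⊖ₛ qpow a

qpow-⊛ : ∀ a f → (qpow a ⊛ f) ≈ shift a f
qpow-⊛ zero    f zero    = ℤₚ.*-identityˡ (f 0)
qpow-⊛ zero    f (suc n) = begin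
  (qpow 0 ⊛ f) (suc n)                       ≡⟨ ⊛-head (qpow 0) f n ⟩
  + 1 *ℤ f (suc n) +ℤ ((λ _ → + 0) ⊛ f) n    ≡⟨ cong₂ _+ℤ_ (ℤₚ.*-identityˡ (f (suc n))) (⊛-zeroˡ f n) ⟩
  f (suc n) +ℤ + 0                           ≡⟨ ℤₚ.+-identityʳ (f (suc n)) ⟩
  f (suc n)                                  ∎
qpow-⊛ (suc a) f zero    = refl
qpow-⊛ (suc a) f (suc n) =
  trans (⊛-head (qpow (suc a)) f n) (trans (ℤₚ.+-identityˡ _) (qpow-⊛ a f n))

oneMinus-⊛ : ∀ a f → (oneMinus a ⊛ f) ≈ Δ a f
oneMinus-⊛ a f n = begin
  (oneMinus a ⊛ f) n
    ≡⟨ ⊛-cong {g = f} (λ i → flip (one i) (qpow a i)) (λ _ → refl) n ⟩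
  ((λ i → - + 1 *ℤ qpow a i +ℤ one i) ⊛ f) n
    ≡⟨ ⊛-linearˡ (- + 1) (qpow a) one f n ⟩
  - + 1 *ℤ (qpow a ⊛ f) n +ℤ (one ⊛ f) n
    ≡⟨ cong₂ (λ x y → - + 1 *ℤ x +ℤ y) (qpow-⊛ a f n) (⊛-identityˡ f n) ⟩
  - + 1 *ℤ shift a f n +ℤ f n
    ≡⟨ flip (f n) (shift a f n) ⟨
  Δ a f n ∎
  where
  flip : ∀ x y → x - y ≡ - + 1 *ℤ y +ℤ x
  flip = solve-∀

-- Partitions with at most k parts

-- Generating function of the partitions that fit in a k by b box. The two recursions below are the
-- two q-Pascal rules.
boundedParts : ℕ → ℕ → Series
boundedParts k b n = + decSeqs k b n

infixl 6 _⊕_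
_⊕_ : Series → Series → Series
(f ⊕ g) n = f n +ℤ g n

shift-⊕ : ∀ a f g → shift a (f ⊕ g) ≈ (shift a f ⊕ shift a g)
shift-⊕ zero    f g n       = refl
shift-⊕ (suc a) f g zero    = refl
shift-⊕ (suc a) f g (suc n) = shift-⊕ a f g n

-- The defining sum runs over the largest part; raising the bound adds the summand with largest part
-- b + 1, present only if b + 1 ≤ n.
boundedParts-bound : ∀ k b →
  boundedParts (suc k) (suc b) ≈ (boundedParts (suc k) b ⊕ shift (suc b) (boundedParts k (suc b)))
boundedParts-bound k b n with suc b ≤? n
... | yes b<n = begin
  + sumℕ (suc b ⊓ n) h
    ≡⟨ cong (λ m → + sumℕ m h) (ℕₚ.m≤n⇒m⊓n≡m b<n) ⟩
  + (sumℕ b h) +ℤ boundedParts k (suc b) (n ∸ suc b)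
    ≡⟨ cong₂ _+ℤ_ (cong (λ m → + sumℕ m h) (sym (ℕₚ.m≤n⇒m⊓n≡m (ℕₚ.<⇒≤ b<n))))
                  (trans (sym (shift-+ (suc b) _ (n ∸ suc b)))
                         (cong (shift (suc b) (boundedParts k (suc b))) (ℕₚ.m+[n∸m]≡n b<n))) ⟩
  + sumℕ (b ⊓ n) h +ℤ shift (suc b) (boundedParts k (suc b)) n ∎
  where
  h : ℕ → ℕ
  h x = decSeqs k x (n ∸ x)
... | no b≮n = begin
  + sumℕ (suc b ⊓ n) h
    ≡⟨ cong (λ m → + sumℕ m h) (trans (ℕₚ.m≥n⇒m⊓n≡n (ℕₚ.m≤n⇒m≤1+n n≤b)) (sym (ℕₚ.m≥n⇒m⊓n≡n n≤b))) ⟩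
  + sumℕ (b ⊓ n) h
    ≡⟨ ℤₚ.+-identityʳ _ ⟨
  + sumℕ (b ⊓ n) h +ℤ + 0
    ≡⟨ cong (+ sumℕ (b ⊓ n) h +ℤ_) (shift-< _ (ℕₚ.≰⇒> b≮n)) ⟨
  + sumℕ (b ⊓ n) h +ℤ shift (suc b) (boundedParts k (suc b)) n ∎
  where
  h : ℕ → ℕ
  h x = decSeqs k x (n ∸ x)
  n≤b : n ≤ b
  n≤b = ℕₚ.≮⇒≥ b≮n

boundedParts-zero : ∀ k → boundedParts k 0 ≈ one
boundedParts-zero zero    zero    = refl
boundedParts-zero zero    (suc n) = refl
boundedParts-zero (suc k) n       = boundedParts-zero k n

boundedParts-0 : ∀ b → boundedParts 0 b ≈ one
boundedParts-0 b zero    = refl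
boundedParts-0 b (suc n) = refl

-- Either some part is zero, or 1 can be subtracted from every part.
boundedParts-parts : ∀ k b →
  boundedParts (suc k) (suc b) ≈ (boundedParts k (suc b) ⊕ shift (suc k) (boundedParts (suc k) b))
boundedParts-parts zero zero n = begin
  boundedParts 1 1 n
    ≡⟨ boundedParts-bound 0 0 n ⟩
  boundedParts 1 0 n +ℤ shift 1 (boundedParts 0 1) n
    ≡⟨ cong₂ _+ℤ_ (trans (boundedParts-zero 1 n) (sym (boundedParts-0 1 n)))
         (shift-cong 1 (λ m → trans (boundedParts-0 1 m) (sym (boundedParts-zero 1 m))) n) ⟩
  boundedParts 0 1 n +ℤ shift 1 (boundedParts 1 0) n ∎
boundedParts-parts (suc k) zero n = begin
  boundedParts (suc (suc k)) 1 n
    ≡⟨ boundedParts-bound (suc k) 0 n ⟩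
  c +ℤ shift 1 (boundedParts (suc k) 1) n
    ≡⟨ cong (c +ℤ_) (trans (shift-cong 1 (boundedParts-parts k 0) n)
                           (shift-⊕ 1 (boundedParts k 1) (shift (suc k) (boundedParts (suc k) 0)) n)) ⟩
  c +ℤ (shift 1 (boundedParts k 1) n +ℤ s)
    ≡⟨ ℤₚ.+-assoc c (shift 1 (boundedParts k 1) n) s ⟨
  (c +ℤ shift 1 (boundedParts k 1) n) +ℤ s
    ≡⟨ cong₂ _+ℤ_ (sym (boundedParts-bound k 0 n)) (shift-shift 1 (suc k) (boundedParts (suc k) 0) n) ⟩
  boundedParts (suc k) 1 n +ℤ shift (suc (suc k)) (boundedParts (suc (suc k)) 0) n ∎
  where
  c s : ℤ
  c = boundedParts (suc k) 0 n
  s = shift 1 (shift (suc k) (boundedParts (suc k) 0)) n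
boundedParts-parts zero (suc b) n = begin
  boundedParts 1 (suc (suc b)) n
    ≡⟨ boundedParts-bound 0 (suc b) n ⟩
  boundedParts 1 (suc b) n +ℤ shift (suc (suc b)) (boundedParts 0 (suc (suc b))) n
    ≡⟨ cong₂ _+ℤ_ (boundedParts-parts 0 b n)
         (trans (shift-cong (suc (suc b)) bound-irrelevant n)
                (sym (shift-shift 1 (suc b) (boundedParts 0 (suc b)) n))) ⟩
  (boundedParts 0 (suc b) n +ℤ s) +ℤ t
    ≡⟨ ℤₚ.+-assoc (boundedParts 0 (suc b) n) s t ⟩
  boundedParts 0 (suc b) n +ℤ (s +ℤ t)
    ≡⟨ cong₂ _+ℤ_ (sym (bound-irrelevant n))
         (trans (sym (shift-⊕ 1 (boundedParts 1 b) (shift (suc b) (boundedParts 0 (suc b))) n))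
                (sym (shift-cong 1 (boundedParts-bound 0 b) n))) ⟩
  boundedParts 0 (suc (suc b)) n +ℤ shift 1 (boundedParts 1 (suc b)) n ∎
  where
  s t : ℤ
  s = shift 1 (boundedParts 1 b) n
  t = shift 1 (shift (suc b) (boundedParts 0 (suc b))) n
  bound-irrelevant : boundedParts 0 (suc (suc b)) ≈ boundedParts 0 (suc b)
  bound-irrelevant m = trans (boundedParts-0 (suc (suc b)) m) (sym (boundedParts-0 (suc b) m))
boundedParts-parts (suc k) (suc b) n = begin
  W (suc k′) (suc b′) n
    ≡⟨ boundedParts-bound k′ b′ n ⟩
  W (suc k′) b′ n +ℤ shift (suc b′) (W k′ (suc b′)) n
    -- The induction lowers b in the first term and k in the second. Both sides then consist of the
    -- same four terms.
    ≡⟨ cong₂ _+ℤ_ (boundedParts-parts (suc k) b n)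
         (trans (shift-cong (suc b′) (boundedParts-parts k (suc b)) n)
                (shift-⊕ (suc b′) (W k (suc b′)) (shift k′ (W k′ b′)) n)) ⟩
  (W k′ b′ n +ℤ x) +ℤ (y +ℤ z)
    ≡⟨ regroup (W k′ b′ n) x y z ⟩
  (W k′ b′ n +ℤ y) +ℤ (x +ℤ z)
    ≡⟨ cong₂ _+ℤ_ (sym (boundedParts-bound k b′ n)) (cong (x +ℤ_) exchange) ⟩
  W k′ (suc b′) n +ℤ (x +ℤ shift (suc k′) (shift b′ (W k′ b′)) n)
    ≡⟨ cong (W k′ (suc b′) n +ℤ_)
         (trans (sym (shift-⊕ (suc k′) (W (suc k′) b) (shift b′ (W k′ b′)) n))
                (sym (shift-cong (suc k′) (boundedParts-bound k′ b) n))) ⟩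
  W k′ (suc b′) n +ℤ shift (suc k′) (W (suc k′) b′) n ∎
  where
  W : ℕ → ℕ → Series
  W = boundedParts
  k′ b′ : ℕ
  k′ = suc k
  b′ = suc b
  x y z : ℤ
  x = shift (suc k′) (W (suc k′) b) n
  y = shift (suc b′) (W k (suc b′)) n
  z = shift (suc b′) (shift k′ (W k′ b′)) n
  regroup : ∀ w x y z → (w +ℤ x) +ℤ (y +ℤ z) ≡ (w +ℤ y) +ℤ (x +ℤ z)
  regroup = solve-∀
  exchange : z ≡ shift (suc k′) (shift b′ (W k′ b′)) n
  exchange = begin
    shift (suc b′) (shift k′ (W k′ b′)) n  ≡⟨ shift-shift (suc b′) k′ (W k′ b′) n ⟩
    shift (suc b′ + k′) (W k′ b′) n        ≡⟨ cong (λ a → shift (suc a) (W k′ b′) n) (ℕₚ.+-comm b′ k′) ⟩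
    shift (suc k′ + b′) (W k′ b′) n        ≡⟨ shift-shift (suc k′) b′ (W k′ b′) n ⟨
    shift (suc k′) (shift b′ (W k′ b′)) n  ∎

partitions : ℕ → Series
partitions k n = + pLe k n

-- No part of a partition of n exceeds n, so the summand gained by each larger bound is zero.
boundedParts-stable : ∀ k n d → boundedParts k (d + n) n ≡ partitions k n
boundedParts-stable k       n zero    = refl
boundedParts-stable zero    n (suc d) = trans (boundedParts-0 (suc d + n) n) (sym (boundedParts-0 n n))
boundedParts-stable (suc k) n (suc d) = begin
  boundedParts (suc k) (suc (d + n)) n
    ≡⟨ boundedParts-bound k (d + n) n ⟩
  boundedParts (suc k) (d + n) n +ℤ shift (suc (d + n)) (boundedParts k (suc (d + n))) n
    ≡⟨ cong₂ _+ℤ_ (boundedParts-stable (suc k) n d) (shift-< _ (s≤s (ℕₚ.m≤n+m n d))) ⟩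
  partitions (suc k) n +ℤ + 0
    ≡⟨ ℤₚ.+-identityʳ _ ⟩
  partitions (suc k) n ∎

partitions-0 : partitions 0 ≈ one
partitions-0 n = boundedParts-0 n n

-- The limit of `boundedParts-parts` for growing bound. By induction P_k is the inverse of
-- ∏_{j=1}^{k} (1 - q^j).
partitions-Δ : ∀ k → Δ (suc k) (partitions (suc k)) ≈ partitions k
partitions-Δ k n = begin
  partitions (suc k) n - S
    -- Coefficient n is the same for the bound n + 1, which has the successor form required by
    -- `boundedParts-parts`.
    ≡⟨ cong (_- S) (sym (boundedParts-stable (suc k) n 1)) ⟩
  boundedParts (suc k) (suc n) n - S
    ≡⟨ cong (_- S) (boundedParts-parts k n n) ⟩
  (boundedParts k (suc n) n +ℤ shift (suc k) (boundedParts (suc k) n) n) - S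
    ≡⟨ cong₂ (λ x y → (x +ℤ y) - S) (boundedParts-stable k n 1) unbounded ⟩
  (partitions k n +ℤ S) - S
    ≡⟨ cancel (partitions k n) S ⟩
  partitions k n ∎
  where
  S : ℤ
  S = shift (suc k) (partitions (suc k)) n
  cancel : ∀ x y → (x +ℤ y) - y ≡ x
  cancel = solve-∀
  unbounded : shift (suc k) (boundedParts (suc k) n) n ≡ S
  unbounded with suc k ≤? n
  ... | no  k≮n = trans (shift-< _ (ℕₚ.≰⇒> k≮n)) (sym (shift-< _ (ℕₚ.≰⇒> k≮n)))
  ... | yes k<n with d , refl ← ℕₚ.m≤n⇒∃[o]m+o≡n k<n = begin
    shift (suc k) (boundedParts (suc k) (suc k + d)) (suc k + d) ≡⟨ shift-+ (suc k) _ d ⟩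
    boundedParts (suc k) (suc k + d) d                           ≡⟨ boundedParts-stable (suc k) d (suc k) ⟩
    partitions (suc k) d                                         ≡⟨ shift-+ (suc k) _ d ⟨
    shift (suc k) (partitions (suc k)) (suc k + d)               ∎

-- Gaussian polynomials

-- numerator M k = ∏_{j=1}^{k} (1 - q^{M+j})
numerator : ℕ → ℕ → Series
numerator M zero    = one
numerator M (suc k) = oneMinus (M + suc k) ⊛ numerator M k

-- The quotient formula cleared of denominators. In the step from k to k + 1, P_k is written as (1 -
-- q^{k+1}) P_{k+1}; the new factor, together with 1/(1 - q), completes `qfact (suc k)`.
qfact-split : ∀ M k → qfact (M + k) ≈ ((qfact M ⊛ qfact k) ⊛ (numerator M k ⊛ partitions k))
qfact-split M zero n = begin
  qfact (M + 0) n                             ≡⟨ cong (λ m → qfact m n) (ℕₚ.+-identityʳ M) ⟩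
  qfact M n                                   ≡⟨ solve 1 (λ x → x ⊜ (x ⊕ₘ id) ⊕ₘ (id ⊕ₘ id)) (λ _ → refl) (qfact M) n ⟩
  ((qfact M ⊛ one) ⊛ (one ⊛ one)) n           ≡⟨ ⊛-cong {qfact M ⊛ one} (λ _ → refl) (⊛-cong {one} (λ _ → refl) (λ m → sym (partitions-0 m))) n ⟩
  ((qfact M ⊛ one) ⊛ (one ⊛ partitions 0)) n  ∎
  where open CMSolver ⊛-commutativeMonoid renaming (_⊕_ to _⊕ₘ_)
qfact-split M (suc k) n = begin
  qfact (M + suc k) n
    ≡⟨ cong (λ m → qfact m n) (ℕₚ.+-suc M k) ⟩
  (qfact (M + k) ⊛ (oneMinus (suc (M + k)) ⊛ u)) n
    ≡⟨ ⊛-cong (qfact-split M k) (⊛-cong {g = u} (λ m → cong (λ a → oneMinus a m) (sym (ℕₚ.+-suc M k))) (λ _ → refl)) n ⟩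
  (((A ⊛ B) ⊛ (Z ⊛ partitions k)) ⊛ (Y ⊛ u)) n
    ≡⟨ ⊛-cong {g = Y ⊛ u} (⊛-cong {A ⊛ B} (λ _ → refl) (⊛-cong {Z} (λ _ → refl)
         (λ m → trans (sym (partitions-Δ k m)) (sym (oneMinus-⊛ (suc k) (partitions (suc k)) m))))) (λ _ → refl) n ⟩
  (((A ⊛ B) ⊛ (Z ⊛ (X ⊛ P))) ⊛ (Y ⊛ u)) n
    ≡⟨ solve 7 (λ a b z x p y v →
         ((a ⊕ₘ b) ⊕ₘ (z ⊕ₘ (x ⊕ₘ p))) ⊕ₘ (y ⊕ₘ v) ⊜ (a ⊕ₘ (b ⊕ₘ (x ⊕ₘ v))) ⊕ₘ ((y ⊕ₘ z) ⊕ₘ p))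
         (λ _ → refl) A B Z X P Y u n ⟩
  ((A ⊛ (B ⊛ (X ⊛ u))) ⊛ ((Y ⊛ Z) ⊛ P)) n ∎
  where
  open CMSolver ⊛-commutativeMonoid renaming (_⊕_ to _⊕ₘ_)
  A B Z X P Y u : Series
  A = qfact M
  B = qfact k
  Z = numerator M k
  X = oneMinus (suc k)
  P = partitions (suc k)
  Y = oneMinus (M + suc k)
  u = inv (oneMinus 1)

qfact-0≡1 : ∀ m → qfact m 0 ≡ + 1
qfact-0≡1 zero    = refl
qfact-0≡1 (suc m) = cong (_*ℤ + 1) (qfact-0≡1 m)

gauss-product : ∀ M k → gauss (M + k) k ≈ (numerator M k ⊛ partitions k)
gauss-product M k n = begin
  (qfact (M + k) ⊛ inv (qfact (M + k ∸ k) ⊛ qfact k)) n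
    ≡⟨ cong (λ m → (qfact (M + k) ⊛ inv (qfact m ⊛ qfact k)) n) (ℕₚ.m+n∸n≡m M k) ⟩
  (qfact (M + k) ⊛ inv D) n
    ≡⟨ ⊛-cong {g = inv D} (qfact-split M k) (λ _ → refl) n ⟩
  ((D ⊛ G) ⊛ inv D) n
    ≡⟨ solve 3 (λ d g i → (d ⊕ₘ g) ⊕ₘ i ⊜ (d ⊕ₘ i) ⊕ₘ g) (λ _ → refl) D G (inv D) n ⟩
  ((D ⊛ inv D) ⊛ G) n
    ≡⟨ ⊛-cong {g = G} (⊛-inverseʳ D (cong₂ _*ℤ_ (qfact-0≡1 M) (qfact-0≡1 k))) (λ _ → refl) n ⟩
  (one ⊛ G) n
    ≡⟨ ⊛-identityˡ G n ⟩
  G n ∎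
  where
  open CMSolver ⊛-commutativeMonoid renaming (_⊕_ to _⊕ₘ_)
  D G : Series
  D = qfact M ⊛ qfact k
  G = numerator M k ⊛ partitions k

-- zcoeff k s f is f times the coefficient of z^s in ∏_{j=1}^{k} (1 - z q^j).
zcoeff : ℕ → ℕ → Series → Series
zcoeff k       zero    f = f
zcoeff zero    (suc s) f = λ _ → + 0
zcoeff (suc k) (suc s) f = zcoeff k (suc s) f ⊖ₛ shift (suc k) (zcoeff k s f)

zcoeff-> : ∀ {k s} f → k < s → zcoeff k s f ≈ (λ _ → + 0)
zcoeff-> {zero}  {suc s} f _         n = refl
zcoeff-> {suc k} {suc s} f (s≤s k<s) n = cong₂ _-_
  (zcoeff-> f (ℕₚ.m≤n⇒m≤1+n k<s) n)
  (trans (shift-cong (suc k) (zcoeff-> f k<s) n) (shift-zero (suc k) n))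

zcoeff-Δ : ∀ k s T f → zcoeff k s (Δ T f) ≈ Δ T (zcoeff k s f)
zcoeff-Δ k       zero    T f n = refl
zcoeff-Δ zero    (suc s) T f n = cong (λ x → + 0 - x) (sym (shift-zero T n))
zcoeff-Δ (suc k) (suc s) T f n = begin
  zcoeff k (suc s) (Δ T f) n - shift (suc k) (zcoeff k s (Δ T f)) n
    ≡⟨ cong₂ _-_ (zcoeff-Δ k (suc s) T f n)
         (trans (shift-cong (suc k) (zcoeff-Δ k s T f) n) (shift-Δ (suc k) T (zcoeff k s f) n)) ⟩
  Δ T (zcoeff k (suc s) f) n - Δ T (shift (suc k) (zcoeff k s f)) n
    ≡⟨ Δ-⊖ T (zcoeff k (suc s) f) (shift (suc k) (zcoeff k s f)) n ⟨
  Δ T (zcoeff (suc k) (suc s) f) n ∎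

sumTo-⊖ : ∀ n (f g : Series) → sumTo n (f ⊖ₛ g) ≡ sumTo n f - sumTo n g
sumTo-⊖ zero    f g = refl
sumTo-⊖ (suc n) f g =
  trans (cong (_+ℤ (f (suc n) - g (suc n))) (sumTo-⊖ n f g))
        (regroup (sumTo n f) (sumTo n g) (f (suc n)) (g (suc n)))
  where
  regroup : ∀ x y u v → (x - y) +ℤ (u - v) ≡ (x +ℤ u) - (y +ℤ v)
  regroup = solve-∀

shift-sumTo : ∀ a k (h : ℕ → Series) →
  shift a (λ n → sumTo k (λ s → h s n)) ≈ (λ n → sumTo k (λ s → shift a (h s) n))
shift-sumTo a zero    h n = refl
shift-sumTo a (suc k) h n =
  trans (shift-⊕ a (λ m → sumTo k (λ s → h s m)) (h (suc k)) n)
        (cong (_+ℤ shift a (h (suc k)) n) (shift-sumTo a k h n))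

-- Substitution of z = q^M in the expansion by powers of z. The new factor 1 - z q^{k+1} produces
-- exactly the recursion of `zcoeff`.
numerator-expand : ∀ M k f →
  (numerator M k ⊛ f) ≈ (λ n → sumTo k (λ s → shift (s * M) (zcoeff k s f) n))
numerator-expand M zero    f n = ⊛-identityˡ f n
numerator-expand M (suc k) f n = begin
  ((oneMinus a ⊛ numerator M k) ⊛ f) n
    ≡⟨ ⊛-assoc (oneMinus a) (numerator M k) f n ⟩
  (oneMinus a ⊛ (numerator M k ⊛ f)) n
    ≡⟨ oneMinus-⊛ a (numerator M k ⊛ f) n ⟩
  Δ a (numerator M k ⊛ f) n
    ≡⟨ Δ-cong a (numerator-expand M k f) n ⟩
  sumTo k A - shift a (λ m → sumTo k (λ s → shift (s * M) (zcoeff k s f) m)) n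
    ≡⟨ cong₂ _-_ (sym extend) (trans (shift-sumTo a k (λ s → shift (s * M) (zcoeff k s f)) n)
                                     (sumTo-cong k (λ s _ → exchange s))) ⟩
  (f n +ℤ sumTo k (tail A)) - sumTo k B
    ≡⟨ ℤₚ.+-assoc (f n) (sumTo k (tail A)) (- sumTo k B) ⟩
  f n +ℤ (sumTo k (tail A) - sumTo k B)
    ≡⟨ cong (f n +ℤ_) (sumTo-⊖ k (tail A) B) ⟨
  f n +ℤ sumTo k (tail A ⊖ₛ B)
    ≡⟨ cong (f n +ℤ_) (sumTo-cong k λ s _ →
         sym (shift-⊖ (suc s * M) (zcoeff k (suc s) f) (shift (suc k) (zcoeff k s f)) n)) ⟩
  f n +ℤ sumTo k (λ s → shift (suc s * M) (zcoeff (suc k) (suc s) f) n)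
    ≡⟨ sumTo-head k (λ s → shift (s * M) (zcoeff (suc k) s f) n) ⟨
  sumTo (suc k) (λ s → shift (s * M) (zcoeff (suc k) s f) n) ∎
  where
  a : ℕ
  a = M + suc k
  A B : Series
  A s = shift (s * M) (zcoeff k s f) n
  B s = shift (suc s * M) (shift (suc k) (zcoeff k s f)) n
  -- The z-degree is at most k, so a zero term at s = k + 1 may be added; the terms after s = 0 then
  -- pair off with those of `B`.
  extend : f n +ℤ sumTo k (tail A) ≡ sumTo k A
  extend = begin
    f n +ℤ sumTo k (tail A)   ≡⟨ sumTo-head k A ⟨
    sumTo k A +ℤ A (suc k)    ≡⟨ cong (sumTo k A +ℤ_) (trans (shift-cong (suc k * M) (zcoeff-> f (ℕₚ.n<1+n k)) n) (shift-zero (suc k * M) n)) ⟩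
    sumTo k A +ℤ + 0          ≡⟨ ℤₚ.+-identityʳ (sumTo k A) ⟩
    sumTo k A                 ∎
  exponent : ∀ s → a + s * M ≡ suc s * M + suc k
  exponent s = trans (ℕₚ.+-assoc M (suc k) (s * M))
                     (trans (cong (λ m → M + m) (ℕₚ.+-comm (suc k) (s * M))) (sym (ℕₚ.+-assoc M (s * M) (suc k))))
  exchange : ∀ s → shift a (shift (s * M) (zcoeff k s f)) n ≡ B s
  exchange s = begin
    shift a (shift (s * M) (zcoeff k s f)) n            ≡⟨ shift-shift a (s * M) (zcoeff k s f) n ⟩
    shift (a + s * M) (zcoeff k s f) n                  ≡⟨ cong (λ m → shift m (zcoeff k s f) n) (exponent s) ⟩
    shift (suc s * M + suc k) (zcoeff k s f) n          ≡⟨ shift-shift (suc s * M) (suc k) (zcoeff k s f) n ⟨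
    B s                                                 ∎

-- Periodicity modulo N

-- For c ≤ t: N divides f n for all n ≥ t - c; adding c on the left avoids truncated subtraction.
VanishesMod : ℕ → ℕ → ℕ → Series → Set
VanishesMod N c t f = ∀ n → t ≤ n + c → + N ∣ℤ f n

PeriodicMod : ℕ → ℕ → Series → Set
PeriodicMod N T f = ∀ n → + N ∣ℤ f (T + n) - f n

∣0 : ∀ N {x} → x ≡ + 0 → + N ∣ℤ x
∣0 N refl = Signed.divides (+ 0) refl

vanishes-≈ : ∀ {N c t f g} → f ≈ g → VanishesMod N c t f → VanishesMod N c t g
vanishes-≈ {N} p v n t≤ = subst (+ N ∣ℤ_) (p n) (v n t≤)

vanishes-mono : ∀ {N c d t f} → d ≤ c → VanishesMod N c t f → VanishesMod N d t f
vanishes-mono d≤c v n t≤ = v n (ℕₚ.≤-trans t≤ (ℕₚ.+-monoʳ-≤ n d≤c))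

vanishes-⊖ : ∀ {N c t f g} → VanishesMod N c t f → VanishesMod N c t g → VanishesMod N c t (f ⊖ₛ g)
vanishes-⊖ v w n t≤ = Signed.∣m∣n⇒∣m-n (v n t≤) (w n t≤)

vanishes-shift : ∀ {N c t f} a → VanishesMod N (a + c) t f → VanishesMod N c t (shift a f)
vanishes-shift {N} {c} {t} {f} a v n t≤ with a ≤? n
... | no  a≰n = ∣0 N (shift-< f (ℕₚ.≰⇒> a≰n))
... | yes a≤n with m , refl ← ℕₚ.m≤n⇒∃[o]m+o≡n a≤n =
  subst (+ N ∣ℤ_) (sym (shift-+ a f m)) (v m (subst (t ≤_) regroup t≤))
  where
  regroup : a + m + c ≡ m + (a + c)
  regroup = trans (cong (λ x → x + c) (ℕₚ.+-comm a m)) (ℕₚ.+-assoc m a c)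

vanishes-later : ∀ {N t f} a → VanishesMod N 0 t f → VanishesMod N a (a + t) f
vanishes-later {t = t} a v n t≤ =
  v n (ℕₚ.≤-trans (ℕₚ.+-cancelˡ-≤ a t n (subst (a + t ≤_) (ℕₚ.+-comm n a) t≤)) (ℕₚ.m≤m+n n 0))

-- A crude bound, used only to know that a series is a polynomial mod N; the sharp degree comes from
-- `vanishes-unΔ`.
eventually-Δ : ∀ {N t f} a → VanishesMod N 0 t f → VanishesMod N 0 (a + t) (Δ a f)
eventually-Δ {N} {t} {f} a v = vanishes-⊖ {f = f} (vanishes-mono z≤n v′)
  (vanishes-shift a (vanishes-mono (ℕₚ.≤-reflexive (ℕₚ.+-identityʳ a)) v′))
  where
  v′ : VanishesMod N a (a + t) f
  v′ = vanishes-later a v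

-- Dividing by 1 - q^{a+1} lowers the degree by a + 1 once the quotient is known to be a polynomial
-- mod N, of whatever degree. With b = a + 1, `f n` equals `f (b + n)` minus `Δ b f (b + n)`, so
-- vanishing descends from the range of `u`.
vanishes-unΔ : ∀ {N c t u f} a →
  VanishesMod N 0 u f → VanishesMod N c t (Δ (suc a) f) → VanishesMod N (suc a + c) t f
vanishes-unΔ {N} {c} {t} {u} {f} a ev v n = go u n (ℕₚ.m≤n+m u n)
  where
  recover : ∀ x y → x - (x - y) ≡ y
  recover = solve-∀
  -- Here `m` bounds the distance from n up to u; a move by `suc a` lowers it by at least one.
  go : ∀ m n → u ≤ n + m → t ≤ n + (suc a + c) → + N ∣ℤ f n
  go zero    n u≤ t≤ = ev n u≤
  go (suc m) n u≤ t≤ = subst (+ N ∣ℤ_)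
    (trans (cong (λ x → f (suc a + n) - (f (suc a + n) - x)) (shift-+ (suc a) f n))
           (recover (f (suc a + n)) (f n)))
    (Signed.∣m∣n⇒∣m-n
      (go m (suc a + n)
        (ℕₚ.≤-trans u≤ (subst (λ x → x ≤ suc a + n + m) (sym (ℕₚ.+-suc n m))
          (s≤s (ℕₚ.+-monoˡ-≤ m (ℕₚ.m≤n+m n a)))))
        (ℕₚ.≤-trans t≤ (ℕₚ.+-monoˡ-≤ (suc a + c) (ℕₚ.m≤n+m n (suc a)))))
      (v (suc a + n) (subst (t ≤_) (trans (sym (ℕₚ.+-assoc n (suc a) c)) (cong (λ x → x + c) (ℕₚ.+-comm n (suc a)))) t≤)))

periodic⇒vanishes : ∀ {N} T f → PeriodicMod N T f → VanishesMod N 0 T (Δ T f)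
periodic⇒vanishes {N} T f per n T≤
  with m , refl ← ℕₚ.m≤n⇒∃[o]m+o≡n (subst (T ≤_) (ℕₚ.+-identityʳ n) T≤) =
  subst (λ x → + N ∣ℤ f (T + m) - x) (sym (shift-+ T f m)) (per m)

vanishes⇒periodic : ∀ {N} T f → VanishesMod N 0 T (Δ T f) → PeriodicMod N T f
vanishes⇒periodic {N} T f v n =
  subst (λ x → + N ∣ℤ f (T + n) - x) (shift-+ T f n)
        (v (T + n) (ℕₚ.≤-trans (ℕₚ.m≤m+n T n) (ℕₚ.m≤m+n (T + n) 0)))

periodic-* : ∀ {N} T f m → PeriodicMod N T f → PeriodicMod N (m * T) f
periodic-* {N} T f zero    per n = ∣0 N (ℤₚ.+-inverseʳ (f n))
periodic-* {N} T f (suc m) per n = subst (+ N ∣ℤ_)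
  (trans (telescope (f (T + (m * T + n))) (f (m * T + n)) (f n))
         (cong (λ x → f x - f n) (sym (ℕₚ.+-assoc T (m * T) n))))
  (Signed.∣m∣n⇒∣m+n (per (m * T + n)) (periodic-* T f m per n))
  where
  telescope : ∀ x y z → (x - y) +ℤ (y - z) ≡ x - z
  telescope = solve-∀

-- deg ∏_{j=1}^{k} (1 - q^j)
triangle : ℕ → ℕ
triangle zero    = 0
triangle (suc k) = suc k + triangle k

-- Modulo N, (1 - q^T) p_{≤k} is a polynomial; its product with ∏_{j≤k} (1 - q^j) is 1 - q^T,
-- so its degree is at most T - triangle k.
Δ-partitions-vanishes : ∀ {N t} k T →
  VanishesMod N 0 t (Δ T (partitions k)) → VanishesMod N (triangle k) (suc T) (Δ T (partitions k))
Δ-partitions-vanishes {N} zero T ev n T<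
  with m , refl ← ℕₚ.m≤n⇒∃[o]m+o≡n (subst (suc T ≤_) (ℕₚ.+-identityʳ n) T<) =
  -- The polynomial is now 1 - q^T, with no term beyond exponent T: hence the threshold `suc T`.
  ∣0 N (trans (Δ-cong T partitions-0 (suc T + m))
    (cong (λ x → + 0 - x) (trans (cong (shift T one) (sym (ℕₚ.+-suc T m))) (shift-+ T one (suc m)))))
Δ-partitions-vanishes {N} (suc k) T ev =
  -- Multiplication by 1 - q^{k+1} turns P_{k+1} into P_k; dividing it out again gains k + 1 in the
  -- margin.
  vanishes-unΔ k ev (vanishes-≈ (λ n → sym (peel n))
    (Δ-partitions-vanishes k T (vanishes-≈ peel (eventually-Δ (suc k) ev))))
  where
  peel : Δ (suc k) (Δ T (partitions (suc k))) ≈ Δ T (partitions k)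
  peel n = trans (Δ-comm (suc k) T (partitions (suc k)) n) (Δ-cong T (partitions-Δ k) n)

-- The coefficient of z^s in the product has q-degree at most `triangle k`, so applying it costs no
-- more than that much margin.
zcoeff-vanishes : ∀ {N c t f} k s → VanishesMod N (triangle k + c) t f → VanishesMod N c t (zcoeff k s f)
zcoeff-vanishes {c = c} k       zero    v = vanishes-mono (ℕₚ.m≤n+m c (triangle k)) v
zcoeff-vanishes {N}     zero    (suc s) v n _ = ∣0 N refl
zcoeff-vanishes {c = c} {f = f} (suc k) (suc s) v = vanishes-⊖ {f = zcoeff k (suc s) f}
  (zcoeff-vanishes k (suc s) (vanishes-mono (ℕₚ.+-monoˡ-≤ c (ℕₚ.m≤n+m (triangle k) (suc k))) v))
  (vanishes-shift (suc k) (zcoeff-vanishes k s (vanishes-mono (ℕₚ.≤-reflexive (triangle-suc k c)) v)))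
  where
  triangle-suc : ∀ k c → triangle k + (suc k + c) ≡ suc k + triangle k + c
  triangle-suc k c = trans (sym (ℕₚ.+-assoc (triangle k) (suc k) c)) (cong (λ x → x + c) (ℕₚ.+-comm (triangle k) (suc k)))

-- For s < k every monomial leaves out at least one q^j with j ≥ 1, so the degree stays below
-- `triangle k` and one unit of margin is left.
zcoeff-vanishes-< : ∀ {N c t f k s} → s < k →
  VanishesMod N (triangle k + c) t f → VanishesMod N (suc c) t (zcoeff k s f)
zcoeff-vanishes-< {c = c} {k = suc k} {zero} _ v = vanishes-mono (s≤s (ℕₚ.m≤n+m c (k + triangle k))) v
zcoeff-vanishes-< {c = c} {f = f} {k = suc k} {suc s} (s≤s s<k) v = vanishes-⊖ {f = zcoeff k (suc s) f}
  (zcoeff-vanishes k (suc s) (vanishes-mono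
    (subst (λ x → x ≤ suc k + triangle k + c) (sym (ℕₚ.+-suc (triangle k) c))
      (s≤s (ℕₚ.+-monoˡ-≤ c (ℕₚ.m≤n+m (triangle k) k)))) v))
  (vanishes-shift (suc k) (vanishes-mono (ℕₚ.≤-reflexive (ℕₚ.+-suc (suc k) c))
    (zcoeff-vanishes-< s<k (vanishes-mono (ℕₚ.≤-reflexive
      (trans (sym (ℕₚ.+-assoc (triangle k) (suc k) c)) (cong (λ x → x + c) (ℕₚ.+-comm (triangle k) (suc k))))) v))))

-- The unit of margin left for s < k lowers the threshold `suc T` to T, which makes the series
-- periodic from index 0 on and not merely eventually.
zcoeff-periodic : ∀ {N T k s} → s < k →
  PeriodicMod N T (partitions k) → PeriodicMod N T (zcoeff k s (partitions k))
zcoeff-periodic {N} {T} {k} {s} s<k per = vanishes⇒periodic T (zcoeff k s (partitions k)) λ n T≤ →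
  vanishes-≈ (zcoeff-Δ k s T (partitions k)) vanishes n
    (subst (λ m → suc T ≤ m) (sym (ℕₚ.+-suc n 0)) (s≤s T≤))
  where
  vanishes : VanishesMod N 1 (suc T) (zcoeff k s (Δ T (partitions k)))
  vanishes = zcoeff-vanishes-< s<k (vanishes-mono (ℕₚ.≤-reflexive (ℕₚ.+-identityʳ (triangle k)))
    (Δ-partitions-vanishes k T (periodic⇒vanishes T (partitions k) per)))

-- Multiplying (1 - q^T) P_{j+2} by 1 - q^{j+2} shows that (1 - q^T) P_{j+1} is a polynomial mod N.
-- The sharp bound then puts its degree below T, because `triangle (suc j)` is at least 1.
partitions-periodic-pred : ∀ {N} T j →
  PeriodicMod N T (partitions (suc (suc j))) → PeriodicMod N T (partitions (suc j))
partitions-periodic-pred {N} T j per = vanishes⇒periodic T (partitions (suc j)) λ n T≤ →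
  Δ-partitions-vanishes (suc j) T eventually n
    (ℕₚ.≤-trans (s≤s (subst (T ≤_) (ℕₚ.+-identityʳ n) T≤))
      (subst (suc n ≤_) (sym (ℕₚ.+-suc n (j + triangle j))) (s≤s (ℕₚ.m≤m+n n (j + triangle j)))))
  where
  eventually : VanishesMod N 0 (suc (suc j) + T) (Δ T (partitions (suc j)))
  eventually = vanishes-≈
    (λ n → trans (Δ-comm (suc (suc j)) T (partitions (suc (suc j))) n) (Δ-cong T (partitions-Δ (suc j)) n))
    (eventually-Δ (suc (suc j)) (periodic⇒vanishes T (partitions (suc (suc j))) per))

-- Translating n by a period

sumTo-∣ : ∀ {N} k (f g : Series) →
  (∀ s → s ≤ k → + N ∣ℤ f s - g s) → + N ∣ℤ sumTo k f - sumTo k g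
sumTo-∣ {N} k f g div = subst (+ N ∣ℤ_) (sumTo-⊖ k f g) (go k div)
  where
  go : ∀ k → (∀ s → s ≤ k → + N ∣ℤ f s - g s) → + N ∣ℤ sumTo k (f ⊖ₛ g)
  go zero    div = div 0 z≤n
  go (suc k) div = Signed.∣m∣n⇒∣m+n (go k λ s s≤k → div s (ℕₚ.m≤n⇒m≤1+n s≤k)) (div (suc k) ℕₚ.≤-refl)

shift-block : ∀ s d M β f → shift (s * M) f ((s + d) * M + β) ≡ f (d * M + β)
shift-block s d M β f = begin
  shift (s * M) f ((s + d) * M + β)      ≡⟨ cong (λ x → shift (s * M) f (x + β)) (ℕₚ.*-distribʳ-+ M s d) ⟩
  shift (s * M) f (s * M + d * M + β)    ≡⟨ cong (shift (s * M) f) (ℕₚ.+-assoc (s * M) (d * M) β) ⟩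
  shift (s * M) f (s * M + (d * M + β))  ≡⟨ shift-+ (s * M) f (d * M + β) ⟩
  f (d * M + β)                          ∎

shift-block-< : ∀ {r s M β} f → r < s → β < M → shift (s * M) f (r * M + β) ≡ + 0
shift-block-< {r} {s} {M} {β} f r<s β<M = shift-< f
  (ℕₚ.<-≤-trans (subst (r * M + β <_) (ℕₚ.+-comm (r * M) M) (ℕₚ.+-monoʳ-< (r * M) β<M))
                (ℕₚ.*-monoˡ-≤ M r<s))

-- Counted from the start of the s-th term, the two exponents differ by (d + e) T, a multiple of the
-- period. The value e = 0 aligns blocks on the left, e = 1 on the right.
shift-translate : ∀ {N} T f → PeriodicMod N T f → ∀ s d M e β →
  + N ∣ℤ shift (s * (T + M)) f ((s + d) * (T + M) + (e * T + β)) - shift (s * M) f ((s + d) * M + β)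
shift-translate {N} T f per s d M e β = subst (+ N ∣ℤ_)
  (cong₂ _-_ (trans (cong f (regroup d e T M β)) (sym (shift-block s d (T + M) (e * T + β) f)))
             (sym (shift-block s d M β f)))
  (periodic-* T f (d + e) per (d * M + β))
  where
  regroup : ∀ d e T M β → (d + e) * T + (d * M + β) ≡ d * (T + M) + (e * T + β)
  regroup = ℕ-solve-∀

shift-translate-< : ∀ {N r s M β} T f e → r < s → β < M → e * T + β < T + M →
  + N ∣ℤ shift (s * (T + M)) f (r * (T + M) + (e * T + β)) - shift (s * M) f (r * M + β)
shift-translate-< {N} T f e r<s β<M eT+β<T+M =
  ∣0 N (cong₂ _-_ (shift-block-< f r<s eT+β<T+M) (shift-block-< f r<s β<M))

gauss-expand : ∀ M k α →
  gauss (M + k) k α ≡ sumTo k (λ s → shift (s * M) (zcoeff k s (partitions k)) α)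
gauss-expand M k α = trans (gauss-product M k α) (numerator-expand M k (partitions k) α)

gauss-∣ : ∀ {N} k M M′ α α′ →
  (∀ s → s ≤ k → + N ∣ℤ shift (s * M) (zcoeff k s (partitions k)) α
                        - shift (s * M′) (zcoeff k s (partitions k)) α′) →
  + N ∣ℤ gauss (M + k) k α - gauss (M′ + k) k α′
gauss-∣ {N} k M M′ α α′ div = subst (+ N ∣ℤ_)
  (sym (cong₂ _-_ (gauss-expand M k α) (gauss-expand M′ k α′)))
  (sumTo-∣ k (λ s → shift (s * M) (zcoeff k s (partitions k)) α)
             (λ s → shift (s * M′) (zcoeff k s (partitions k)) α′) div)

module _ {N T : ℕ} (k : ℕ) (per : PeriodicMod N T (partitions k)) where

  -- In block r only the terms with s ≤ r contribute, and r < k restricts them to the periodic F_s.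
  -- The last hypothesis keeps the translated exponent inside block r.
  gauss-translate : ∀ {r M β} e → r < k → β < M → e * T + β < T + M →
    + N ∣ℤ gauss (T + M + k) k (r * (T + M) + (e * T + β)) - gauss (M + k) k (r * M + β)
  gauss-translate {r} {M} {β} e r<k β<M eT+β<T+M =
    gauss-∣ k (T + M) M (r * (T + M) + (e * T + β)) (r * M + β) term
    where
    F : ℕ → Series
    F s = zcoeff k s (partitions k)
    term : ∀ s → s ≤ k →
      + N ∣ℤ shift (s * (T + M)) (F s) (r * (T + M) + (e * T + β)) - shift (s * M) (F s) (r * M + β)
    term s _ with s ≤? r
    ... | no  s≰r = shift-translate-< T (F s) e (ℕₚ.≰⇒> s≰r) β<M eT+β<T+M
    ... | yes s≤r with d , refl ← ℕₚ.m≤n⇒∃[o]m+o≡n s≤r =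
      shift-translate T (F s) (zcoeff-periodic (ℕₚ.≤-<-trans s≤r r<k) per) s d M e β

  -- At exponent k M the term s = k contributes only the constant coefficient of F_k, which is
  -- independent of M; the other terms are periodic.
  gauss-translate-top : ∀ M →
    + N ∣ℤ gauss (T + M + k) k (k * (T + M)) - gauss (M + k) k (k * M)
  gauss-translate-top M = gauss-∣ k (T + M) M (k * (T + M)) (k * M) term
    where
    F : ℕ → Series
    F s = zcoeff k s (partitions k)
    at-top : ∀ s → shift (k * s) (F k) (k * s) ≡ F k 0
    at-top s = trans (cong (shift (k * s) (F k)) (sym (ℕₚ.+-identityʳ (k * s)))) (shift-+ (k * s) (F k) 0)
    term : ∀ s → s ≤ k →
      + N ∣ℤ shift (s * (T + M)) (F s) (k * (T + M)) - shift (s * M) (F s) (k * M)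
    term s s≤k with ℕₚ.m≤n⇒m<n∨m≡n s≤k
    ... | inj₂ refl = ∣0 N (trans (cong₂ _-_ (at-top (T + M)) (at-top M)) (ℤₚ.+-inverseʳ (F k 0)))
    ... | inj₁ s<k with d , refl ← ℕₚ.m≤n⇒∃[o]m+o≡n s≤k = subst (+ N ∣ℤ_)
      (cong₂ (λ x y → shift (s * (T + M)) (F s) x - shift (s * M) (F s) y)
             (ℕₚ.+-identityʳ _) (ℕₚ.+-identityʳ _))
      (shift-translate T (F s) (zcoeff-periodic s<k per) s d M 0 0)

-- Residues

∣-⇒≡-< : ∀ {N a b} .{{_ : NonZero N}} → a < N → b < N → + N ∣ℤ + a - + b → a ≡ b
∣-⇒≡-< {N} {a} {b} a<N b<N div with ℤ.∣ + a - + b ∣ in eq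
... | zero  = ℤₚ.+-injective (ℤₚ.i-j≡0⇒i≡j (+ a) (+ b) (ℤₚ.∣i∣≡0⇒i≡0 eq))
... | suc d = ⊥-elim (>⇒∤ bound (subst (N ∣_) eq (Signed.∣⇒∣ᵤ div)))
  where
  bound : suc d < N
  bound = subst (_< N) (trans (cong ℤ.∣_∣ (sym (ℤₚ.m-n≡m⊖n a b))) eq)
    (ℕₚ.≤-<-trans (ℤₚ.∣m⊝n∣≤m⊔n a b) (ℕₚ.⊔-pres-<m a<N b<N))

∣-⇒%ℕ≡ : ∀ N .{{_ : NonZero N}} a b → + N ∣ℤ a - b → a %ℕ N ≡ b %ℕ N
∣-⇒%ℕ≡ N a b div = ∣-⇒≡-< (n%ℕd<d a N) (n%ℕd<d b N) (subst (+ N ∣ℤ_) remainders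
  (Signed.∣m∣n⇒∣m-n div (Signed.∣n⇒∣m*n (a /ℕ N - b /ℕ N) Signed.∣-refl)))
  where
  cancel : ∀ r q s t n → ((r +ℤ q *ℤ n) - (s +ℤ t *ℤ n)) - (q - t) *ℤ n ≡ r - s
  cancel = solve-∀
  remainders : (a - b) - (a /ℕ N - b /ℕ N) *ℤ + N ≡ + (a %ℕ N) - + (b %ℕ N)
  remainders = trans
    (cong₂ (λ x y → (x - y) - (a /ℕ N - b /ℕ N) *ℤ + N) (a≡a%ℕn+[a/ℕn]*n a N) (a≡a%ℕn+[a/ℕn]*n b N))
    (cancel (+ (a %ℕ N)) (a /ℕ N) (+ (b %ℕ N)) (b /ℕ N) (+ N))

%ℕ≡⇒∣- : ∀ N .{{_ : NonZero N}} a b → a %ℕ N ≡ b %ℕ N → + N ∣ℤ a - b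
%ℕ≡⇒∣- N a b eq = Signed.divides (a /ℕ N - b /ℕ N) (trans
  (cong₂ _-_ (trans (a≡a%ℕn+[a/ℕn]*n a N) (cong (λ r → + r +ℤ (a /ℕ N) *ℤ + N) eq)) (a≡a%ℕn+[a/ℕn]*n b N))
  (cancel (+ (b %ℕ N)) (a /ℕ N) (b /ℕ N) (+ N)))
  where
  cancel : ∀ r q t n → (r +ℤ q *ℤ n) - (r +ℤ t *ℤ n) ≡ (q - t) *ℤ n
  cancel = solve-∀

-- Minimal periods

module _ (N : ℕ) .{{_ : NonZero N}} where

  IsPeriod⇒periodic : ∀ k T → IsPeriod N k T → PeriodicMod N T (partitions k)
  IsPeriod⇒periodic k T (_ , per) n = %ℕ≡⇒∣- N (partitions k (T + n)) (partitions k n)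
    (trans (cong (λ m → pLe k m % N) (ℕₚ.+-comm T n)) (per n))

  periodic⇒IsPeriod : ∀ k T → 1 ≤ T → PeriodicMod N T (partitions k) → IsPeriod N k T
  periodic⇒IsPeriod k T 1≤T per = 1≤T , λ n →
    trans (cong (λ m → pLe k m % N) (ℕₚ.+-comm n T))
          (∣-⇒%ℕ≡ N (partitions k (T + n)) (partitions k n) (per n))

  -- A nonzero remainder of T modulo p would itself be a period, smaller than p.
  minimal-∣ : ∀ k {p} T → IsMinimalPeriod N k p → PeriodicMod N T (partitions k) → p ∣ T
  minimal-∣ k {p@(suc _)} T (isPer , minimal) per with T % p in eq
  ... | zero  = m%n≡0⇒n∣m T p eq
  ... | suc r = ⊥-elim (ℕₚ.<⇒≱ (subst (_< p) eq (m%n<n T p))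
    (minimal (suc r) (periodic⇒IsPeriod k (suc r) (s≤s z≤n) remainder)))
    where
    q : ℕ
    q = T / p
    f : Series
    f = partitions k
    T≡ : T ≡ q * p + suc r
    T≡ = trans (m≡m%n+[m/n]*n T p) (trans (cong (_+ q * p) eq) (ℕₚ.+-comm (suc r) (q * p)))
    cancel : ∀ x y z → (x - z) - (x - y) ≡ y - z
    cancel = solve-∀
    remainder : PeriodicMod N (suc r) f
    remainder n = subst (+ N ∣ℤ_) (cancel (f (T + n)) (f (suc r + n)) (f n))
      (Signed.∣m∣n⇒∣m-n (per n) (subst (λ m → + N ∣ℤ f m - f (suc r + n))
        (trans (sym (ℕₚ.+-assoc (q * p) (suc r) n)) (cong (_+ n) (sym T≡)))
        (periodic-* p f q (IsPeriod⇒periodic k p isPer) (suc r + n))))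

  module _ (π : ℕ → ℕ) (isMin : ∀ j → 1 ≤ j → IsMinimalPeriod N j (π j)) where

    π-∣-suc : ∀ j → π (suc j) ∣ π (suc (suc j))
    π-∣-suc j = minimal-∣ (suc j) (π (suc (suc j))) (isMin (suc j) (s≤s z≤n))
      (partitions-periodic-pred (π (suc (suc j))) j (IsPeriod⇒periodic (suc (suc j)) (π (suc (suc j))) (proj₁ (isMin (suc (suc j)) (s≤s z≤n)))))

    divℕ-* : ∀ {a b} → 1 ≤ b → b ∣ a → divℕ a b * b ≡ a
    divℕ-* {b = suc _} _ b∣a = m/n*n≡m b∣a

    π-∣-ratio* : ∀ j {x} → π (suc j) ∣ x → π (suc (suc j)) ∣ divℕ (π (suc (suc j))) (π (suc j)) * x
    π-∣-ratio* j {x} π∣x = subst (_∣ ratio * x)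
      (divℕ-* (proj₁ (proj₁ (isMin (suc j) (s≤s z≤n)))) (π-∣-suc j)) (*-monoʳ-∣ ratio π∣x)
      where
      ratio : ℕ
      ratio = divℕ (π (suc (suc j))) (π (suc j))

    -- Both branches of `pi'` multiply by the ratio of consecutive minimal periods, which is exact
    -- by `π-∣-suc`; an extra factor N preserves divisibility.
    π∣pi' : ∀ j → π (suc j) ∣ pi' N π (suc j)
    π∣pi' zero    = ∣-refl
    π∣pi' (suc j) with does (N ∣? divℕ (π (suc (suc j))) (π (suc j)))
    ... | true  = π-∣-ratio* j (π∣pi' j)
    ... | false = subst (π (suc (suc j)) ∣_)
      (sym (ℕₚ.*-assoc N (divℕ (π (suc (suc j))) (π (suc j))) (pi' N π (suc j))))
      (∣n⇒∣m*n N (π-∣-ratio* j (π∣pi' j)))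

    pi'-periodic : ∀ {k} → 1 ≤ k → PeriodicMod N (pi' N π k) (partitions k)
    pi'-periodic {suc j} 1≤k with divides q eq ← π∣pi' j =
      subst (λ T → PeriodicMod N T (partitions (suc j))) (sym eq)
        (periodic-* (π (suc j)) (partitions (suc j)) q (IsPeriod⇒periodic (suc j) (π (suc j)) (proj₁ (isMin (suc j) 1≤k))))

-- Counting

sumBelow : ℕ → (ℕ → ℕ) → ℕ
sumBelow zero    f = 0
sumBelow (suc n) f = sumBelow n f + f n

sumBelow-cong : ∀ n {f g} → (∀ i → i < n → f i ≡ g i) → sumBelow n f ≡ sumBelow n g
sumBelow-cong zero    eq = refl
sumBelow-cong (suc n) eq =
  cong₂ _+_ (sumBelow-cong n λ i i<n → eq i (ℕₚ.m<n⇒m<1+n i<n)) (eq n (ℕₚ.n<1+n n))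

sumBelow-+ : ∀ m n f → sumBelow (m + n) f ≡ sumBelow m f + sumBelow n (λ i → f (m + i))
sumBelow-+ m zero    f = trans (cong (λ x → sumBelow x f) (ℕₚ.+-identityʳ m)) (sym (ℕₚ.+-identityʳ _))
sumBelow-+ m (suc n) f = begin
  sumBelow (m + suc n) f                                        ≡⟨ cong (λ x → sumBelow x f) (ℕₚ.+-suc m n) ⟩
  sumBelow (m + n) f + f (m + n)                                ≡⟨ cong (_+ f (m + n)) (sumBelow-+ m n f) ⟩
  sumBelow m f + sumBelow n (λ i → f (m + i)) + f (m + n)       ≡⟨ ℕₚ.+-assoc (sumBelow m f) _ _ ⟩
  sumBelow m f + sumBelow (suc n) (λ i → f (m + i))             ∎

sumBelow-pointwise-+ : ∀ n f g → sumBelow n (λ i → f i + g i) ≡ sumBelow n f + sumBelow n g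
sumBelow-pointwise-+ zero    f g = refl
sumBelow-pointwise-+ (suc n) f g =
  trans (cong (_+ (f n + g n)) (sumBelow-pointwise-+ n f g))
        (regroup (sumBelow n f) (sumBelow n g) (f n) (g n))
  where
  regroup : ∀ x y u v → (x + y) + (u + v) ≡ (x + u) + (y + v)
  regroup = ℕ-solve-∀

sumBelow-* : ∀ k M f → sumBelow (k * M) f ≡ sumBelow k (λ r → sumBelow M (λ β → f (r * M + β)))
sumBelow-* zero    M f = refl
sumBelow-* (suc k) M f = begin
  sumBelow (M + k * M) f                                         ≡⟨ cong (λ x → sumBelow x f) (ℕₚ.+-comm M (k * M)) ⟩
  sumBelow (k * M + M) f                                         ≡⟨ sumBelow-+ (k * M) M f ⟩
  sumBelow (k * M) f + sumBelow M (λ β → f (k * M + β))          ≡⟨ cong (_+ sumBelow M (λ β → f (k * M + β))) (sumBelow-* k M f) ⟩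
  sumBelow (suc k) (λ r → sumBelow M (λ β → f (r * M + β)))      ∎

indicator : ℕ → ℕ → ℕ
indicator R v = if does (v ≟ R) then 1 else 0

length-filter-upTo : ∀ (h : ℕ → ℕ) R n →
  length (filter (λ α → h α ≟ R) (upTo n)) ≡ sumBelow n (λ α → indicator R (h α))
length-filter-upTo h R zero    = refl
length-filter-upTo h R (suc n) = begin
  length (filter P? (upTo (suc n)))                        ≡⟨ cong (λ xs → length (filter P? xs)) (upTo-∷ʳ n) ⟨
  length (filter P? (upTo n ++ n ∷ []))                    ≡⟨ cong length (filter-++ P? (upTo n) (n ∷ [])) ⟩
  length (filter P? (upTo n) ++ filter P? (n ∷ []))        ≡⟨ length-++ (filter P? (upTo n)) ⟩
  length (filter P? (upTo n)) + length (filter P? (n ∷ [])) ≡⟨ cong₂ _+_ (length-filter-upTo h R n) last ⟩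
  sumBelow n (λ α → indicator R (h α)) + indicator R (h n) ∎
  where
  P? : ∀ α → Dec (h α ≡ R)
  P? α = h α ≟ R
  last : length (filter P? (n ∷ [])) ≡ indicator R (h n)
  last with does (h n ≟ R)
  ... | true  = refl
  ... | false = refl

-- c M α plays the role of the indicator of [q^α] ∏_{j≤k} (1 - q^{M+j})/(1 - q^j) ≡ R.
module _ (k T : ℕ) (c : ℕ → ℕ → ℕ)
  (c-start : ∀ {r M β} → r < k → β < M → c (T + M) (r * (T + M) + β) ≡ c M (r * M + β))
  (c-end   : ∀ {r M β} → r < k → β < M → c (T + M) (r * (T + M) + (T + β)) ≡ c M (r * M + β))
  (c-top   : ∀ M → c (T + M) (k * (T + M)) ≡ c M (k * M))
  where

  total : ℕ → ℕ
  total M = sumBelow (suc (k * M)) (c M)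

  -- The contribution of the last T exponents of each block when the block length is T + M.
  increment : ℕ → ℕ
  increment M = sumBelow k (λ r → sumBelow T (λ β → c (T + M) (r * (T + M) + (M + β))))

  -- Right alignment: these last T exponents keep their residues when the blocks grow by another T.
  increment-periodic : ∀ M → increment (T + M) ≡ increment M
  increment-periodic M = sumBelow-cong k λ r r<k → sumBelow-cong T λ β β<T →
    trans (cong (λ x → c (T + (T + M)) (r * (T + (T + M)) + x)) (ℕₚ.+-assoc T M β))
          (c-end r<k (subst (_< T + M) (ℕₚ.+-comm β M) (ℕₚ.+-monoˡ-< M β<T)))

  -- Left alignment: the first M exponents of each block, and the top exponent, reproduce the old
  -- count. What remains is the increment.
  total-translate : ∀ M → total (T + M) ≡ total M + increment M
  total-translate M = begin
    sumBelow (k * (T + M)) (c (T + M)) + c (T + M) (k * (T + M))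
      ≡⟨ cong₂ _+_ (sumBelow-* k (T + M) (c (T + M))) (c-top M) ⟩
    sumBelow k (λ r → sumBelow (T + M) (block r)) + c M (k * M)
      ≡⟨ cong (_+ c M (k * M)) (sumBelow-cong k split) ⟩
    sumBelow k (λ r → old r + new r) + c M (k * M)
      ≡⟨ cong (_+ c M (k * M)) (sumBelow-pointwise-+ k old new) ⟩
    sumBelow k old + increment M + c M (k * M)
      ≡⟨ regroup (sumBelow k old) (increment M) (c M (k * M)) ⟩
    sumBelow k old + c M (k * M) + increment M
      ≡⟨ cong (λ x → x + c M (k * M) + increment M) (sumBelow-* k M (c M)) ⟨
    total M + increment M ∎
    where
    block : ℕ → ℕ → ℕ
    block r β = c (T + M) (r * (T + M) + β)
    old new : ℕ → ℕ
    old r = sumBelow M (λ β → c M (r * M + β))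
    new r = sumBelow T (λ β → block r (M + β))
    regroup : ∀ x y z → x + y + z ≡ x + z + y
    regroup = ℕ-solve-∀
    split : ∀ r → r < k → sumBelow (T + M) (block r) ≡ old r + new r
    split r r<k = begin
      sumBelow (T + M) (block r)        ≡⟨ cong (λ x → sumBelow x (block r)) (ℕₚ.+-comm T M) ⟩
      sumBelow (M + T) (block r)        ≡⟨ sumBelow-+ M T (block r) ⟩
      sumBelow M (block r) + new r      ≡⟨ cong (_+ new r) (sumBelow-cong M λ β β<M → c-start r<k β<M) ⟩
      old r + new r                     ∎

  increment-* : ∀ d M → increment (d * T + M) ≡ increment M
  increment-* zero    M = refl
  increment-* (suc d) M = trans (cong increment (ℕₚ.+-assoc T (d * T) M))
    (trans (increment-periodic (d * T + M)) (increment-* d M))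

  total-linear : ∀ d M → total (d * T + M) ≡ total M + d * increment M
  total-linear zero    M = sym (ℕₚ.+-identityʳ (total M))
  total-linear (suc d) M = begin
    total (T + d * T + M)                               ≡⟨ cong total (ℕₚ.+-assoc T (d * T) M) ⟩
    total (T + (d * T + M))                             ≡⟨ total-translate (d * T + M) ⟩
    total (d * T + M) + increment (d * T + M)           ≡⟨ cong₂ _+_ (total-linear d M) (increment-* d M) ⟩
    total M + d * increment M + increment M             ≡⟨ regroup (total M) d (increment M) ⟩
    total M + suc d * increment M                       ∎
    where
    regroup : ∀ x d y → x + d * y + y ≡ x + (1 + d) * y
    regroup = ℕ-solve-∀

-- Linearity along arithmetic progressions

fkR-linear : ∀ N .{{_ : NonZero N}} {T} k (R : Fin N) → PeriodicMod N T (partitions k) →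
  ∀ M → Σ ℕ λ E → ∀ d → fkR N k R (d * T + M + k) ≡ fkR N k R (M + k) + d * E
fkR-linear N {T} k R per M = increment k T c c-start c-end c-top M , λ d → begin
  fkR N k R (d * T + M + k)      ≡⟨ fkR-total (d * T + M) ⟩
  total k T c c-start c-end c-top (d * T + M)  ≡⟨ total-linear k T c c-start c-end c-top d M ⟩
  total k T c c-start c-end c-top M + d * increment k T c c-start c-end c-top M
    ≡⟨ cong (_+ d * increment k T c c-start c-end c-top M) (fkR-total M) ⟨
  fkR N k R (M + k) + d * increment k T c c-start c-end c-top M ∎
  where
  residue : ℕ → ℕ → ℕ
  residue M α = gauss (M + k) k α %ℕ N
  c : ℕ → ℕ → ℕ
  c M α = indicator (toℕ R) (residue M α)
  c-≡ : ∀ M M′ α α′ → + N ∣ℤ gauss (M + k) k α - gauss (M′ + k) k α′ → c M α ≡ c M′ α′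
  c-≡ M M′ α α′ div = cong (indicator (toℕ R)) (∣-⇒%ℕ≡ N (gauss (M + k) k α) (gauss (M′ + k) k α′) div)
  c-start : ∀ {r M β} → r < k → β < M → c (T + M) (r * (T + M) + β) ≡ c M (r * M + β)
  c-start {r} {M} {β} r<k β<M = c-≡ (T + M) M (r * (T + M) + β) (r * M + β)
    (gauss-translate k per {r} {M} {β} 0 r<k β<M (ℕₚ.<-≤-trans β<M (ℕₚ.m≤n+m M T)))
  c-end : ∀ {r M β} → r < k → β < M → c (T + M) (r * (T + M) + (T + β)) ≡ c M (r * M + β)
  c-end {r} {M} {β} r<k β<M =
    trans (cong (λ x → c (T + M) (r * (T + M) + (x + β))) (sym (ℕₚ.*-identityˡ T)))
      (c-≡ (T + M) M (r * (T + M) + (1 * T + β)) (r * M + β) (gauss-translate k per {r} {M} {β} 1 r<k β<M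
        (subst (λ x → x + β < T + M) (sym (ℕₚ.*-identityˡ T)) (ℕₚ.+-monoʳ-< T β<M))))
  c-top : ∀ M → c (T + M) (k * (T + M)) ≡ c M (k * M)
  c-top M = c-≡ (T + M) M (k * (T + M)) (k * M) (gauss-translate-top k per M)
  fkR-total : ∀ M → fkR N k R (M + k) ≡ total k T c c-start c-end c-top M
  fkR-total M = trans (length-filter-upTo (residue M) (toℕ R) (suc (k * (M + k ∸ k))))
    (cong (λ x → sumBelow (suc (k * x)) (c M)) (ℕₚ.m+n∸n≡m M k))

least : ∀ {P : ℕ → Set} → (∀ m → Dec (P m)) → ∀ {n} → P n → Σ ℕ λ m → P m × (∀ l → P l → m ≤ l)
least P? {n} Pn with P? 0
... | yes P0 = 0 , P0 , λ _ _ → z≤n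
least P? {zero}  Pn | no ¬P0 = ⊥-elim (¬P0 Pn)
least P? {suc n} Pn | no ¬P0 with m , Pm , min ← least (λ m → P? (suc m)) Pn =
  suc m , Pm , λ { zero P0 → ⊥-elim (¬P0 P0) ; (suc l) Pl → s≤s (min l Pl) }

-- The coefficients are read off at the first index m₀ in the range k ≤ n, hence may be negative.
linear-on-progression : ∀ (f : ℕ → ℕ) {k Q} i → 0 < Q →
  (∀ M → Σ ℕ λ E → ∀ d → f (d * Q + M + k) ≡ f (M + k) + d * E) →
  ∃₂ λ (a b : ℤ) → ∀ m → k ≤ i + m * Q → + f (i + m * Q) ≡ a *ℤ + m +ℤ b
linear-on-progression f {k} {Q} i 0<Q increments
  -- The index m = k already lies in the range, because Q ≥ 1.
  with m₀ , k≤ , minimal ← least (λ m → k ≤? i + m * Q) {k}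
         (ℕₚ.≤-trans (ℕₚ.m≤m*n k Q {{ℕ.>-nonZero 0<Q}}) (ℕₚ.m≤n+m (k * Q) i))
  with E , linear ← increments (i + m₀ * Q ∸ k) =
  + E , + f₀ - + E *ℤ + m₀ , values
  where
  M₀ f₀ : ℕ
  M₀ = i + m₀ * Q ∸ k
  f₀ = f (M₀ + k)
  rearrange : ∀ e f m d → f +ℤ d *ℤ e ≡ e *ℤ (m +ℤ d) +ℤ (f - e *ℤ m)
  rearrange = solve-∀
  regroup : ∀ i m d q → i + (m + d) * q ≡ d * q + (i + m * q)
  regroup = ℕ-solve-∀
  index : ∀ d → i + (m₀ + d) * Q ≡ d * Q + M₀ + k
  index d = begin
    i + (m₀ + d) * Q       ≡⟨ regroup i m₀ d Q ⟩
    d * Q + (i + m₀ * Q)   ≡⟨ cong (λ x → d * Q + x) (ℕₚ.m∸n+n≡m k≤) ⟨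
    d * Q + (M₀ + k)       ≡⟨ ℕₚ.+-assoc (d * Q) M₀ k ⟨
    d * Q + M₀ + k         ∎
  values : ∀ m → k ≤ i + m * Q → + f (i + m * Q) ≡ + E *ℤ + m +ℤ (+ f₀ - + E *ℤ + m₀)
  values m k≤m with d , refl ← ℕₚ.m≤n⇒∃[o]m+o≡n (minimal m k≤m) = begin
    + f (i + (m₀ + d) * Q)                          ≡⟨ cong (λ n → + f n) (index d) ⟩
    + f (d * Q + M₀ + k)                            ≡⟨ cong +_ (linear d) ⟩
    + f₀ +ℤ + (d * E)                               ≡⟨ cong (+ f₀ +ℤ_) (ℤₚ.pos-* d E) ⟩
    + f₀ +ℤ + d *ℤ + E                              ≡⟨ rearrange (+ E) (+ f₀) (+ m₀) (+ d) ⟩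
    + E *ℤ (+ m₀ +ℤ + d) +ℤ (+ f₀ - + E *ℤ + m₀)    ∎

theorem4p3 : (N : ℕ) .{{_ : NonZero N}} (π : ℕ → ℕ)
    → (∀ j → 1 ≤ j → IsMinimalPeriod N j (π j))
    → (k : ℕ) → 1 ≤ k → (R : Fin N)
    → ∀ i → i < pi' N π k
    → ∃₂ λ (a b : ℤ) → ∀ (m : ℕ) → k ≤ i + m * pi' N π k
    → + fkR N k R (i + m * pi' N π k) ≡ a *ℤ + m +ℤ b
theorem4p3 N π isMin k 1≤k R i i<Q = linear-on-progression (fkR N k R) i
  -- Positivity of the quasi-period is read off from i < Q.
  (ℕₚ.≤-<-trans z≤n i<Q) (fkR-linear N k R (pi'-periodic N π isMin 1≤k))
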